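{- The following two equalities of classes of languages hold: (1) $\text{A-P-sel} = \text{CA-P-sel}$, i.e., a set $B\subseteq\Sigma^*$ has an associative $\mathrm{FP}_t$-selector function if and only if it has an $\mathrm{FP}_t$-selector function that is both commutative and associative. (2) $\text{A-NP-sel} = \text{CA-NP-sel}$, i.e., a set $B\subseteq\Sigma^*$ has an associative $\mathrm{NPSV}_t$-selector function if and only if it has an $\mathrm{NPSV}_t$-selector function that is both commutative and associative.
   Context: $\Sigma=\{0,1\}$. All functions considered here are total, single-valued and 2-ary, $f:\Sigma^*\times\Sigma^*\to\Sigma^*$. $\mathrm{FP}_t$ is the class of such functions computable in deterministic polynomial time. $\mathrm{NPSV}_t$ is the class of such functions $f$ for which there is a nondeterministic polynomial-time Turing machine $M$ such that for all $x,y$ the set of strings output on accepting paths of $M(x,y)$ is exactly $\{f(x,y)\}$. For a class $\mathcal F$ of such functions, $f\in\mathcal F$ is an $\mathcal F$-selector function for a set $B\subseteq\Sigma^*$ if for all $x,y$: $f(x,y)\in\{x,y\}$, and if $x\in B$ or $y\in B$ then $f(x,y)\in B$. $f$ is associative if $f(a,f(b,c))=f(f(a,b),c)$ for all $a,b,c\in\Sigma^*$, and commutative if $f(a,b)=f(b,a)$ for all $a,b\in\Sigma^*$. A-P-sel (respectively A-NP-sel) is the class of sets having an associative $\mathrm{FP}_t$-selector (respectively $\mathrm{NPSV}_t$-selector) function; CA-P-sel (respectively CA-NP-sel) is the class of sets having a commutative and associative $\mathrm{FP}_t$-selector (respectively $\mathrm{NPSV}_t$-selector) function. -}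

module Defs where

open import Algebra.Core using (Op₂)
open import Algebra.Definitions using (Associative; Commutative)
open import Data.Bool.Base using (Bool; true)
open import Data.Fin.Base using (Fin)
open import Data.List.Base using (List; []; _∷_; _++_; map; length; fromMaybe)
open import Data.List.Membership.Propositional using (_∈_)
open import Data.Maybe.Base using (Maybe)
open import Data.Nat.Base using (ℕ; zero; suc; _+_; _*_; _≤_)
open import Data.Product.Base using (Σ; ∃-syntax; _×_; _,_)
open import Data.Sum.Base using (_⊎_)
open import Data.Vec.Base as Vec using (Vec; []; _∷_)
open import Function.Bundles using (_↔_; _⇔_)
open import Level using (0ℓ) renaming (suc to lsuc)
open import Relation.Binary.PropositionalEquality.Core using (_≡_)
open import Relation.Unary using (Pred)

-- Strings over {0,1}, with false for 0 and true for 1.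
Word : Set
Word = List Bool

Language : Set₁
Language = Pred Word 0ℓ

-- Coefficients are listed from the constant term upwards.
Polynomial : Set
Polynomial = List ℕ

eval : Polynomial → ℕ → ℕ
eval []      n = 0
eval (c ∷ p) n = c + n * eval p n

-- The tape alphabet consists of the blank, the two input symbols and an
-- arbitrary finite number of auxiliary symbols.
data Symbol (a : ℕ) : Set where
  blank : Symbol a
  bit   : Bool → Symbol a
  aux   : Fin a → Symbol a

data Move : Set where
  left stay right : Move

-- A two-way infinite tape with finitely many non-blank cells.  The field
-- before lists the cells to the left of the head, nearest first; after
-- lists those to its right, nearest first.  All unlisted cells are blank.
record Tape (a : ℕ) : Set where
  constructor tape
  field
    before : List (Symbol a)
    head   : Symbol a
    after  : List (Symbol a)

open Tape public

-- Outermost blanks are never stored, so each half-tape reached in a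
-- computation has a unique representation.
push : ∀ {a} → Symbol a → List (Symbol a) → List (Symbol a)
push blank [] = []
push s     ss = s ∷ ss

write : ∀ {a} → Symbol a → Tape a → Tape a
write s (tape ls _ rs) = tape ls s rs

move : ∀ {a} → Move → Tape a → Tape a
move left  (tape []       s rs)       = tape [] blank (push s rs)
move left  (tape (l ∷ ls) s rs)       = tape ls l (push s rs)
move stay  t                          = t
move right (tape ls       s [])       = tape (push s ls) blank []
move right (tape ls       s (r ∷ rs)) = tape (push s ls) r rs

blankTape : ∀ {a} → Tape a
blankTape = tape [] blank []

-- The head starts on the first symbol of the word.
inputTape : ∀ {a} → Word → Tape a
inputTape []       = blankTape
inputTape (b ∷ bs) = tape [] (bit b) (map bit bs)

record Action (State : Set) (a k : ℕ) : Set where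
  constructor action
  field
    next  : State
    edits : Vec (Symbol a × Move) k
    emit  : Maybe Bool

record Config (State : Set) (a k : ℕ) : Set where
  constructor config
  field
    state    : State
    contents : Vec (Tape a) k
    output   : Word

open Action public
open Config public

edit : ∀ {a} → Tape a → Symbol a × Move → Tape a
edit t (s , m) = move m (write s t)

perform : ∀ {Q a k} → Config Q a k → Action Q a k → Config Q a k
perform (config _ ts o) (action q es e) =
  config q (Vec.zipWith edit ts es) (o ++ fromMaybe e)

-- Nondeterministic multitape Turing transducers with two inputs: the first
-- two tapes initially hold the arguments, the `work` remaining ones are
-- blank, and all of them may be read and overwritten.  In addition there is
-- a one-way write-only output tape, to which each step appends at most one
-- bit.
record Machine : Set₁ where
  field
    State     : Set
    size      : ℕ
    finite    : State ↔ Fin size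
    auxiliary : ℕ
    work      : ℕ
    start     : State
    accepting : State → Bool
    δ         : State → Vec (Symbol auxiliary) (2 + work) →
                List (Action State auxiliary (2 + work))

  Conf : Set
  Conf = Config State auxiliary (2 + work)

  initial : Word → Word → Conf
  initial x y =
    config start (inputTape x ∷ inputTape y ∷ Vec.replicate work blankTape) []

  actions : Conf → List (Action State auxiliary (2 + work))
  actions (config q ts _) = δ q (Vec.map head ts)

  successors : Conf → List Conf
  successors c = map (perform c) (actions c)

  -- Path c n d: some computation path leads from c to d in exactly n steps.
  data Path (c : Conf) : ℕ → Conf → Set where
    done : Path c zero c
    step : ∀ {n d e} → d ∈ successors c → Path d n e → Path c (suc n) e

  Accepts : Conf → Set
  Accepts c = actions c ≡ [] × accepting (state c) ≡ true

  -- Some accepting computation path on input (x , y) outputs z.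
  Outputs : Word → Word → Word → Set
  Outputs x y z = ∃[ n ] ∃[ c ] Path (initial x y) n c × Accepts c × output c ≡ z

  Deterministic : Set
  Deterministic = ∀ q ss → length (δ q ss) ≤ 1

  -- Every computation path, accepting or not, halts within the time bound.
  PolynomialTime : Set
  PolynomialTime = Σ Polynomial λ p → ∀ x y {n c} →
    Path (initial x y) n c → n ≤ eval p (length x + length y)

  -- The set of strings output on accepting paths is exactly {f(x,y)}.
  Computes : Op₂ Word → Set
  Computes f = ∀ x y z → Outputs x y z ⇔ z ≡ f x y

open Machine public using (Deterministic; PolynomialTime; Computes)

-- Classes of total, single-valued, 2-ary functions.
FunctionClass : Set₂
FunctionClass = Pred (Op₂ Word) (lsuc 0ℓ)

-- A deterministic machine has a single maximal path; it computes f if that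
-- path always accepts with output f(x,y).
FPₜ : FunctionClass
FPₜ f = Σ Machine λ M → Deterministic M × PolynomialTime M × Computes M f

NPSVₜ : FunctionClass
NPSVₜ f = Σ Machine λ M → PolynomialTime M × Computes M f

record Selector (𝓕 : FunctionClass) (B : Language) (f : Op₂ Word) : Set₁ where
  field
    member  : 𝓕 f
    chooses : ∀ x y → f x y ≡ x ⊎ f x y ≡ y
    selects : ∀ x y → B x ⊎ B y → B (f x y)

LanguageClass : Set₂
LanguageClass = Pred Language (lsuc 0ℓ)

A-sel : FunctionClass → LanguageClass
A-sel 𝓕 B = ∃[ f ] Selector 𝓕 B f × Associative _≡_ f

CA-sel : FunctionClass → LanguageClass
CA-sel 𝓕 B = ∃[ f ] Selector 𝓕 B f × Commutative _≡_ f × Associative _≡_ f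

A-P-sel CA-P-sel A-NP-sel CA-NP-sel : LanguageClass
A-P-sel   = A-sel FPₜ
CA-P-sel  = CA-sel FPₜ
A-NP-sel  = A-sel NPSVₜ
CA-NP-sel = CA-sel NPSVₜ

{-# OPTIONS --safe #-}
-- Replace a selector f by g(x,y) = f(min(x,y), max(x,y)) for the lexicographic
-- order.  Commutativity is immediate; as g picks one of its arguments, it is
-- associative as soon as the relation g(x,y) = y has no 3-cycles, and in a
-- 3-cycle the associative law of f at the sorted triple identifies all three
-- points.  A machine for g walks over the common prefix of the two inputs
-- until their order is decided, returns to the first symbols, and then runs
-- the machine for f with the first two tapes interchanged if necessary.
module Submission where

open import Defs
open import Algebra.Core using (Op₂)
open import Algebra.Definitions using (Associative; Commutative; Selective)
open import Data.Bool.Base as Bool using (Bool; true; false)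
open import Data.Bool.Properties as Bool using ()
open import Data.Fin.Base using (Fin)
open import Data.Fin.Properties using (1↔⊤; 2↔Bool; +↔⊎; *↔×)
open import Data.List.Base using (List; []; _∷_; map; length; _ʳ++_)
open import Data.List.Membership.Propositional using (_∈_)
open import Data.List.Membership.Propositional.Properties using (∈-map⁺; ∈-map⁻)
open import Data.List.Properties using (length-map; map-∘; map-cong)
open import Data.List.Relation.Binary.Lex.NonStrict as Lex using (Lex-≤; base; halt; this)
open import Data.List.Relation.Binary.Pointwise using (Pointwise-≡⇒≡; ≡⇒Pointwise-≡)
open import Data.List.Relation.Unary.Any using (here)
open import Data.Maybe.Base using (Maybe; just; nothing; maybe′)
open import Data.Nat.Base using (ℕ; suc; _+_; _*_; _≤_; z≤n; s≤s)
open import Data.Nat.Properties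
  using (≤-trans; ≤-refl; m≤n+m; m≤m+n; +-comm; +-suc; +-monoˡ-≤; +-mono-≤; module ≤-Reasoning)
open import Data.Nat.Solver using (module +-*-Solver)
open import Data.Product.Base using (∃-syntax; _×_; _,_)
open import Data.Product.Function.NonDependent.Propositional using (_×-↔_)
open import Data.Sum.Base using (_⊎_; inj₁; inj₂; [_,_]′; swap)
open import Data.Sum.Function.Propositional using (_⊎-↔_)
open import Data.Unit.Base using (⊤; tt)
open import Data.Vec.Base as Vec using (Vec; []; _∷_)
open import Data.Vec.Properties using (zipWith-replicate)
open import Function.Base using (const)
open import Function.Bundles using (_↔_; mk⇔; module Equivalence)
open import Function.Properties.Inverse using (↔-sym; ↔-trans)
open import Relation.Binary.PropositionalEquality
open import Relation.Binary.Structures using (IsTotalOrder)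
open import Relation.Unary using (_≐_)

-- Sorting the arguments of an operation

module Sorting {A : Set} {_≼_ : A → A → Set} (isTotalOrder : IsTotalOrder _≡_ _≼_) where

  open IsTotalOrder isTotalOrder using (total; antisym) renaming (trans to ≼-trans)

  onSorted : Op₂ A → Op₂ A
  onSorted f x y = [ const (f x y) , const (f y x) ]′ (total x y)

  -- If `total` reports the opposite comparison, antisymmetry makes the two arguments equal, so the
  -- branch taken does not matter.
  onSorted-≼ : ∀ f {x y} → x ≼ y → onSorted f x y ≡ f x y
  onSorted-≼ f {x} {y} x≼y with total x y
  ... | inj₁ _   = refl
  ... | inj₂ y≼x with refl ← antisym x≼y y≼x = refl

  onSorted-≽ : ∀ f {x y} → y ≼ x → onSorted f x y ≡ f y x
  onSorted-≽ f {x} {y} y≼x with total x y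
  ... | inj₁ x≼y with refl ← antisym x≼y y≼x = refl
  ... | inj₂ _   = refl

  onSorted-comm : ∀ f → Commutative _≡_ (onSorted f)
  onSorted-comm f x y with total x y
  ... | inj₁ x≼y = sym (onSorted-≽ f x≼y)
  ... | inj₂ y≼x = sym (onSorted-≼ f y≼x)

  onSorted-sel : ∀ {f} → Selective _≡_ f → Selective _≡_ (onSorted f)
  onSorted-sel sel x y with total x y
  ... | inj₁ _ = sel x y
  ... | inj₂ _ = swap (sel y x)

  module _ {f : Op₂ A} (sel : Selective _≡_ f) (assoc : Associative _≡_ f) where

    private
      g : Op₂ A
      g = onSorted f

      g-comm : Commutative _≡_ g
      g-comm = onSorted-comm f

      open ≡-Reasoning

    -- As `p` is least, two edges of the cycle read `f p q ≡ q` and `f p r ≡ p`. The third gives `f`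
    -- on the sorted pair of `q` and `r`, and associativity of `f` at the sorted triple equates `p`
    -- with the largest point.
    cycle-least : ∀ {p q r} → p ≼ q → p ≼ r →
                  g p q ≡ q → g q r ≡ r → g r p ≡ p → p ≡ r
    cycle-least {p} {q} {r} p≼q p≼r pq qr rp = [ q≼r-case , r≼q-case ]′ (total q r)
      where
      f-pq : f p q ≡ q
      f-pq = trans (sym (onSorted-≼ f p≼q)) pq

      f-pr : f p r ≡ p
      f-pr = trans (sym (onSorted-≽ f p≼r)) rp

      q≼r-case : q ≼ r → p ≡ r
      q≼r-case q≼r = begin
        p            ≡⟨ f-pr ⟨
        f p r        ≡⟨ cong (f p) f-qr ⟨
        f p (f q r)  ≡⟨ assoc p q r ⟨
        f (f p q) r  ≡⟨ cong (λ u → f u r) f-pq ⟩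
        f q r        ≡⟨ f-qr ⟩
        r            ∎
        where
        f-qr : f q r ≡ r
        f-qr = trans (sym (onSorted-≼ f q≼r)) qr

      r≼q-case : r ≼ q → p ≡ r
      r≼q-case r≼q = begin
        p      ≡⟨ rp ⟨
        g r p  ≡⟨ g-comm r p ⟩
        g p r  ≡⟨ cong (λ u → g u r) p≡q ⟩
        g q r  ≡⟨ qr ⟩
        r      ∎
        where
        p≡q : p ≡ q
        p≡q = begin
          p            ≡⟨ f-pr ⟨
          f p r        ≡⟨ cong (f p) (trans (sym (onSorted-≽ f r≼q)) qr) ⟨
          f p (f r q)  ≡⟨ assoc p r q ⟨
          f (f p r) q  ≡⟨ cong (λ u → f u q) f-pr ⟩
          f p q        ≡⟨ f-pq ⟩
          q            ∎

    -- The hypotheses are invariant under rotation, so `cycle-least` can start at the least point.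
    -- If it identifies a pair other than `a` and `c`, the two edges at the remaining point evaluate
    -- one pair in both orders, and commutativity finishes.
    cycle-trivial : ∀ {a b c} → g a b ≡ b → g b c ≡ c → g c a ≡ a → a ≡ c
    cycle-trivial {a} {b} {c} ab bc ca = [ a≼b-case , b≼a-case ]′ (total a b)
      where
      least-a : a ≼ b → a ≼ c → a ≡ c
      least-a a≼b a≼c = cycle-least a≼b a≼c ab bc ca

      least-b : b ≼ c → b ≼ a → a ≡ c
      least-b b≼c b≼a with refl ← cycle-least b≼c b≼a bc ca ab =
        trans (sym ca) (trans (g-comm c a) bc)

      least-c : c ≼ a → c ≼ b → a ≡ c
      least-c c≼a c≼b with refl ← cycle-least c≼a c≼b ca ab bc =
        trans (sym ca) (trans (g-comm c a) ab)

      a≼b-case : a ≼ b → a ≡ c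
      a≼b-case a≼b = [ least-a a≼b , (λ c≼a → least-c c≼a (≼-trans c≼a a≼b)) ]′ (total a c)

      b≼a-case : b ≼ a → a ≡ c
      b≼a-case b≼a =
        [ (λ b≼c → least-b b≼c b≼a) , (λ c≼b → least-c (≼-trans c≼b b≼a) c≼b) ]′ (total b c)

    -- By selectivity the only alternative is `g a c ≡ a`, which closes a 3-cycle.
    onSorted-trans : ∀ {a b c} → g a b ≡ b → g b c ≡ c → g a c ≡ c
    onSorted-trans {a} {b} {c} ab bc with onSorted-sel sel a c
    ... | inj₂ ac = ac
    ... | inj₁ ac = trans ac (cycle-trivial ab bc (trans (g-comm c a) ac))

    -- Read `g x y ≡ y` as an arrow from `x` to `y`. If both arrows leave `b`, both sides are
    -- `g a c`; if both enter `b`, both sides are `b`; if they form a path, transitivity evaluates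
    -- `g a c` to its endpoint.
    onSorted-assoc : Associative _≡_ g
    onSorted-assoc a b c with onSorted-sel sel a b | onSorted-sel sel b c
    ... | inj₁ ab | inj₁ bc = begin
      g (g a b) c  ≡⟨ cong (λ u → g u c) ab ⟩
      g a c        ≡⟨ g-comm a c ⟩
      g c a        ≡⟨ onSorted-trans (trans (g-comm c b) bc) (trans (g-comm b a) ab) ⟩
      a            ≡⟨ ab ⟨
      g a b        ≡⟨ cong (g a) bc ⟨
      g a (g b c)  ∎
    ... | inj₁ ab | inj₂ bc = trans (cong (λ u → g u c) ab) (cong (g a) (sym bc))
    ... | inj₂ ab | inj₁ bc = begin
      g (g a b) c  ≡⟨ cong (λ u → g u c) ab ⟩
      g b c        ≡⟨ bc ⟩
      b            ≡⟨ ab ⟨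
      g a b        ≡⟨ cong (g a) bc ⟨
      g a (g b c)  ∎
    ... | inj₂ ab | inj₂ bc = begin
      g (g a b) c  ≡⟨ cong (λ u → g u c) ab ⟩
      g b c        ≡⟨ bc ⟩
      c            ≡⟨ onSorted-trans ab bc ⟨
      g a c        ≡⟨ cong (g a) bc ⟨
      g a (g b c)  ∎

-- Lexicographic order on words and the transfer of selectors

infix 4 _≼_

_≼_ : Word → Word → Set
_≼_ = Lex-≤ _≡_ Bool._≤_

≼-isTotalOrder : IsTotalOrder _≡_ _≼_
≼-isTotalOrder = record
  { isPartialOrder = record
    { isPreorder = record
      { isEquivalence = isEquivalence
      ; reflexive     = λ x≡y → ≼.reflexive (≡⇒Pointwise-≡ x≡y)
      ; trans         = ≼.trans
      }
    ; antisym = λ x≼y y≼x → Pointwise-≡⇒≡ (≼.antisym x≼y y≼x)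
    }
  ; total = ≼.total
  }
  where module ≼ = IsTotalOrder (Lex.≤-isTotalOrder Bool._≟_ Bool.≤-isTotalOrder)

open Sorting ≼-isTotalOrder

module _ {𝓕 : FunctionClass} (closed : ∀ {f} → 𝓕 f → 𝓕 (onSorted f)) where

  onSorted-selector : ∀ {B f} → Selector 𝓕 B f → Selector 𝓕 B (onSorted f)
  onSorted-selector {B} {f} s = record
    { member  = closed (Selector.member s)
    ; chooses = onSorted-sel (Selector.chooses s)
    ; selects = selects
    }
    where
    selects : ∀ x y → B x ⊎ B y → B (onSorted f x y)
    selects x y p with IsTotalOrder.total ≼-isTotalOrder x y
    ... | inj₁ _ = Selector.selects s x y p
    ... | inj₂ _ = Selector.selects s y x (swap p)

  -- All that is asked of the class is `closed`, so the deterministic and the nondeterministic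
  -- equality share this argument.
  A-sel≐CA-sel : A-sel 𝓕 ≐ CA-sel 𝓕
  A-sel≐CA-sel =
      (λ (f , s , assoc) → onSorted f , onSorted-selector s , onSorted-comm f ,
                           onSorted-assoc (Selector.chooses s) assoc)
    , (λ (f , s , _ , assoc) → f , s , assoc)

-- Exchanging the first two tapes

swapIf : ∀ {A : Set} {k} → Bool → Vec A (2 + k) → Vec A (2 + k)
swapIf false xs           = xs
swapIf true  (x ∷ y ∷ xs) = y ∷ x ∷ xs

swapIf-involutive : ∀ {A : Set} {k} b (xs : Vec A (2 + k)) → swapIf b (swapIf b xs) ≡ xs
swapIf-involutive false xs           = refl
swapIf-involutive true  (x ∷ y ∷ xs) = refl

map-swapIf : ∀ {A B : Set} {k} (f : A → B) b (xs : Vec A (2 + k)) →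
             Vec.map f (swapIf b xs) ≡ swapIf b (Vec.map f xs)
map-swapIf f false xs           = refl
map-swapIf f true  (x ∷ y ∷ xs) = refl

zipWith-swapIf : ∀ {A B C : Set} {k} (f : A → B → C) b (xs : Vec A (2 + k)) ys →
                 Vec.zipWith f (swapIf b xs) (swapIf b ys) ≡ swapIf b (Vec.zipWith f xs ys)
zipWith-swapIf f false xs           ys           = refl
zipWith-swapIf f true  (x ∷ y ∷ xs) (u ∷ v ∷ ys) = refl

-- Forced computations

module _ (M : Machine) where

  open Machine M

  -- The unique computation from c passes through d after at most n steps.
  data Forced (c : Conf) : ℕ → Conf → Set where
    done : ∀ {n} → Forced c n c
    step : ∀ {n d e} → successors c ≡ d ∷ [] → Forced d n e → Forced c (suc n) e

  Forced-weaken : ∀ {c m n d} → m ≤ n → Forced c m d → Forced c n d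
  Forced-weaken _         done       = done
  Forced-weaken (s≤s m≤n) (step s w) = step s (Forced-weaken m≤n w)

  Forced-extend : ∀ {c n d m e} → Forced c n d → Path d m e → ∃[ l ] Path c l e
  Forced-extend done       w = _ , w
  Forced-extend (step s v) w with _ , w′ ← Forced-extend v w =
    _ , step (subst (_ ∈_) (sym s) (here refl)) w′

  -- A halted path cannot end strictly inside the forced segment, where every configuration has a
  -- successor; hence it runs through `d`.
  Forced-shorten : ∀ {c n d l e} → Forced c n d → Path c l e → actions e ≡ [] → ∃[ m ] Path d m e
  Forced-shorten done       w    _      = _ , w
  Forced-shorten (step s v) done halted with () ← trans (sym s) (cong (map _) halted)
  Forced-shorten (step s v) (step d∈ w) halted with here refl ← subst (_ ∈_) s d∈ =
    Forced-shorten v w halted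

  Forced-bound : ∀ {c n d t l e} → Forced c n d → (∀ {m e} → Path d m e → m ≤ t) →
                 Path c l e → l ≤ n + t
  Forced-bound {n = n} done bound w = ≤-trans (bound w) (m≤n+m _ n)
  Forced-bound (step s v) bound done = z≤n
  Forced-bound (step s v) bound (step d∈ w) with here refl ← subst (_ ∈_) s d∈ =
    s≤s (Forced-bound v bound w)

-- The machine that sorts its inputs

-- For current symbols that settle the order of the two inputs, tells whether
-- they have to be exchanged.
verdict : ∀ {a} → Symbol a → Symbol a → Maybe Bool
verdict (bit false) (bit false) = nothing
verdict (bit false) (bit true)  = just false
verdict (bit true)  (bit false) = just true
verdict (bit true)  (bit true)  = nothing
verdict (bit _)     _           = just true
verdict _           _           = just false

Ordered : Bool → Word → Word → Set
Ordered false x y = x ≼ y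
Ordered true  x y = y ≼ x

Ordered-∷ : ∀ b c {x y} → Ordered b x y → Ordered b (c ∷ x) (c ∷ y)
Ordered-∷ false c x≼y = Lex.next refl x≼y
Ordered-∷ true  c y≼x = Lex.next refl y≼x

module SortInputs (M : Machine) where

  private module M = Machine M

  pattern scan     = inj₁ tt
  pattern rewind b = inj₂ (inj₁ b)
  pattern run b q  = inj₂ (inj₂ (b , q))

  -- The verdict is remembered in the state: the tapes are never copied, and in `run` the exchange
  -- only permutes what `M` reads and writes.
  State′ : Set
  State′ = ⊤ ⊎ (Bool ⊎ Bool × M.State)

  finite′ : State′ ↔ Fin (1 + (2 + 2 * M.size))
  finite′ = ↔-sym (↔-trans +↔⊎ (1↔⊤ ⊎-↔ ↔-trans +↔⊎
    (2↔Bool ⊎-↔ ↔-trans *↔× (2↔Bool ×-↔ ↔-sym M.finite))))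

  Action′ : Set
  Action′ = Action State′ M.auxiliary (2 + M.work)

  Symbols : Set
  Symbols = Vec (Symbol M.auxiliary) (2 + M.work)

  -- The symbols read are written back, so only the heads move. Writing blanks on the work tapes is
  -- harmless, as these are still blank before `run`.
  sweep : State′ → Move → (s t : Symbol M.auxiliary) → Action′
  sweep q m s t =
    action q ((s , m) ∷ (t , m) ∷ Vec.replicate M.work (blank , stay)) nothing

  scanAction : Symbols → Action′
  scanAction (s ∷ t ∷ _) =
    maybe′ (λ b → sweep (rewind b) left s t) (sweep scan right s t) (verdict s t)

  -- The first tape alone suffices: both heads move in lockstep and reach the blank before their
  -- words together.
  rewindAction : Bool → Symbols → Action′
  rewindAction b (s@(bit _) ∷ t ∷ _) = sweep (rewind b) left s t
  rewindAction b (s         ∷ t ∷ _) = sweep (run b M.start) right s t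

  relay : Bool → Action M.State M.auxiliary (2 + M.work) → Action′
  relay b (action q es e) = action (run b q) (swapIf b es) e

  accepting′ : State′ → Bool
  accepting′ (run _ q) = M.accepting q
  accepting′ _         = false

  δ′ : State′ → Symbols → List Action′
  δ′ scan       ss = scanAction ss ∷ []
  δ′ (rewind b) ss = rewindAction b ss ∷ []
  δ′ (run b q)  ss = map (relay b) (M.δ q (swapIf b ss))

  sorter : Machine
  sorter = record
    { State     = State′
    ; size      = _
    ; finite    = finite′
    ; auxiliary = M.auxiliary
    ; work      = M.work
    ; start     = scan
    ; accepting = accepting′
    ; δ         = δ′
    }

  private module M′ = Machine sorter

  sorter-deterministic : Deterministic M → Deterministic sorter
  sorter-deterministic det scan       ss = s≤s z≤n
  sorter-deterministic det (rewind b) ss = s≤s z≤n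
  sorter-deterministic det (run b q)  ss =
    subst (_≤ 1) (sym (length-map (relay b) (M.δ q (swapIf b ss)))) (det q (swapIf b ss))

  -- Step-by-step simulation of `M` in the `run` phase

  embed : Bool → M.Conf → M′.Conf
  embed b (config q ts o) = config (run b q) (swapIf b ts) o

  perform-relay : ∀ b c α → perform (embed b c) (relay b α) ≡ embed b (perform c α)
  perform-relay b (config q ts o) (action q′ es e) =
    cong (λ us → config _ us _) (zipWith-swapIf edit b ts es)

  -- `embed` exchanges the tapes and `δ′` exchanges the symbols read; the two cancel.
  actions-embed : ∀ b c → M′.actions (embed b c) ≡ map (relay b) (M.actions c)
  actions-embed b (config q ts o) = cong (λ ss → map (relay b) (M.δ q ss))
    (trans (cong (swapIf b) (map-swapIf head b ts)) (swapIf-involutive b _))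

  successors-embed : ∀ b c → M′.successors (embed b c) ≡ map (embed b) (M.successors c)
  successors-embed b c = begin
    map (perform (embed b c)) (M′.actions (embed b c))
      ≡⟨ cong (map _) (actions-embed b c) ⟩
    map (perform (embed b c)) (map (relay b) (M.actions c))
      ≡⟨ map-∘ (M.actions c) ⟨
    map (λ α → perform (embed b c) (relay b α)) (M.actions c)
      ≡⟨ map-cong (perform-relay b c) (M.actions c) ⟩
    map (λ α → embed b (perform c α)) (M.actions c)
      ≡⟨ map-∘ (M.actions c) ⟩
    map (embed b) (M.successors c) ∎
    where open ≡-Reasoning

  embed-path : ∀ b {c n d} → M.Path c n d → M′.Path (embed b c) n (embed b d)
  embed-path b M.done = M′.done
  embed-path b {c} (M.step d∈ w) =
    M′.step (subst (_ ∈_) (sym (successors-embed b c)) (∈-map⁺ (embed b) d∈)) (embed-path b w)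

  path-embed : ∀ b {c n d′} → M′.Path (embed b c) n d′ → ∃[ d ] M.Path c n d × d′ ≡ embed b d
  path-embed b M′.done = _ , M.done , refl
  path-embed b {c} (M′.step d∈ w)
    with _ , e∈ , refl ← ∈-map⁻ (embed b) (subst (_ ∈_) (successors-embed b c) d∈)
    with _ , v , eq ← path-embed b w = _ , M.step e∈ v , eq

  embed-accepts : ∀ b {c} → M.Accepts c → M′.Accepts (embed b c)
  embed-accepts b {c} (halted , acc) = trans (actions-embed b c) (cong (map _) halted) , acc

  accepts-embed : ∀ b {c} → M′.Accepts (embed b c) → M.Accepts c
  accepts-embed b {c} (halted , acc) = map-[] (trans (sym (actions-embed b c)) halted) , acc
    where
    map-[] : ∀ {A B : Set} {h : A → B} {xs} → map h xs ≡ [] → xs ≡ []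
    map-[] {xs = []} _ = refl

  -- The tape of the word p ʳ++ w with the head on the first symbol of w.
  tapeAt : Word → Word → Tape M.auxiliary
  tapeAt p []      = tape (map bit p) blank []
  tapeAt p (b ∷ w) = tape (map bit p) (bit b) (map bit w)

  tapeBefore : Word → Tape M.auxiliary
  tapeBefore w = tape [] blank (map bit w)

  inputTape≡tapeAt : ∀ w → inputTape w ≡ tapeAt [] w
  inputTape≡tapeAt []      = refl
  inputTape≡tapeAt (_ ∷ _) = refl

  move-right : ∀ p c w → move right (tapeAt p (c ∷ w)) ≡ tapeAt (c ∷ p) w
  move-right p c []      = refl
  move-right p c (_ ∷ _) = refl

  -- Exact even when the head is past the end of the word, because `push` discards the blank left
  -- behind.
  move-left : ∀ p c w → move left (tapeAt (c ∷ p) w) ≡ tapeAt p (c ∷ w)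
  move-left p c []      = refl
  move-left p c (_ ∷ _) = refl

  move-left-start : ∀ w → move left (tapeAt [] w) ≡ tapeBefore w
  move-left-start []      = refl
  move-left-start (_ ∷ _) = refl

  move-right-start : ∀ w → move right (tapeBefore w) ≡ inputTape w
  move-right-start []      = refl
  move-right-start (_ ∷ _) = refl

  -- The scan and rewind phases

  conf : State′ → Tape M.auxiliary → Tape M.auxiliary → M′.Conf
  conf q s t = config q (s ∷ t ∷ Vec.replicate M.work blankTape) []

  -- Writing back the symbol under the head restores the tape by eta for `Tape`.
  perform-sweep : ∀ q {q′ m s t s′ t′} → move m s ≡ s′ → move m t ≡ t′ →
                  perform (conf q s t) (sweep q′ m (head s) (head t)) ≡ conf q′ s′ t′
  perform-sweep q {m = m} {s} {t} refl refl =
    cong (λ us → config _ (move m s ∷ move m t ∷ us) [])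
      (zipWith-replicate edit blankTape (blank , stay))

  rewind-start : ∀ b x y → M′.successors (conf (rewind b) (tapeBefore x) (tapeBefore y)) ≡
                 conf (run b M.start) (inputTape x) (inputTape y) ∷ []
  rewind-start b x y =
    cong (_∷ []) (perform-sweep (rewind b) (move-right-start x) (move-right-start y))

  Return : Bool → Word → Word → ℕ → M′.Conf → Set
  Return b x y n c = Forced sorter c n (conf (run b M.start) (inputTape x) (inputTape y))

  -- Taken just after a left move, so that one induction on `p` covers both a head on the prefix and
  -- a head on the blank before it.
  rewindFrom : Bool → Word → Word → Word → M′.Conf
  rewindFrom b p x y = conf (rewind b) (move left (tapeAt p x)) (move left (tapeAt p y))

  rewind-forced : ∀ b p x y → Return b (p ʳ++ x) (p ʳ++ y) (suc (length p)) (rewindFrom b p x y)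
  rewind-forced b [] x y
    rewrite move-left-start x | move-left-start y = step (rewind-start b x y) done
  rewind-forced b (c ∷ p) x y
    rewrite move-left p c x | move-left p c y =
      step (cong (_∷ []) (perform-sweep (rewind b) refl refl)) (rewind-forced b p (c ∷ x) (c ∷ y))

  -- At most `length x` steps forward and as many back, `length p` more to the start, one step for
  -- the verdict and one to enter `run`.
  scanTime : Word → Word → ℕ
  scanTime p x = length x + (length x + (2 + length p))

  ScanFrom : Word → Word → Word → Set
  ScanFrom p x y = ∃[ b ] Ordered b x y ×
    Return b (p ʳ++ x) (p ʳ++ y) (scanTime p x) (conf scan (tapeAt p x) (tapeAt p y))

  scan-decide : ∀ b p x y → verdict (head (tapeAt p x)) (head (tapeAt p y)) ≡ just b →
                Ordered b x y → ScanFrom p x y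
  scan-decide b p x y eq ord = b , ord , Forced-weaken sorter bound
      (step (cong (_∷ []) decided) (rewind-forced b p x y))
    where
    bound : 2 + length p ≤ scanTime p x
    bound = ≤-trans (m≤n+m _ (length x)) (m≤n+m _ (length x))

    c : M′.Conf
    c = conf scan (tapeAt p x) (tapeAt p y)

    decided : perform c (scanAction (Vec.map head (contents c))) ≡ rewindFrom b p x y
    decided rewrite eq = perform-sweep scan refl refl

  scan-continue : ∀ p c x y → verdict {M.auxiliary} (bit c) (bit c) ≡ nothing →
                  ScanFrom (c ∷ p) x y → ScanFrom p (c ∷ x) (c ∷ y)
  scan-continue p c x y eq (b , ord , forced) =
      b , Ordered-∷ b c ord , Forced-weaken sorter bound (step (cong (_∷ []) advanced) forced)
    where
    -- The step forward and the longer way back cost one each, paid for by the two summands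
    -- `length x`.
    bound : suc (scanTime (c ∷ p) x) ≤ scanTime p (c ∷ x)
    bound rewrite +-suc (length x) (suc (suc (length p)))
                | +-suc (length x) (length x + suc (suc (length p))) = ≤-refl

    d : M′.Conf
    d = conf scan (tapeAt p (c ∷ x)) (tapeAt p (c ∷ y))

    advanced : perform d (scanAction (Vec.map head (contents d))) ≡
               conf scan (tapeAt (c ∷ p) x) (tapeAt (c ∷ p) y)
    advanced rewrite eq = perform-sweep scan (move-right p c x) (move-right p c y)

  scan-forced : ∀ p x y → ScanFrom p x y
  scan-forced p []            []            = scan-decide false p [] [] refl (base tt)
  scan-forced p []            y@(_ ∷ _)     = scan-decide false p [] y refl halt
  -- Splitting on the first bit lets `verdict` compute.
  scan-forced p x@(true  ∷ _) []            = scan-decide true p x [] refl halt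
  scan-forced p x@(false ∷ _) []            = scan-decide true p x [] refl halt
  scan-forced p (false ∷ x)   (false ∷ y)   = scan-continue p false x y refl (scan-forced _ x y)
  -- `this` asks for the strict order derived from `Bool._≤_`: the comparison together with
  -- inequality.
  scan-forced p x@(false ∷ _) y@(true ∷ _)  =
    scan-decide false p x y refl (this (Bool.f≤t , λ ()))
  scan-forced p x@(true ∷ _)  y@(false ∷ _) =
    scan-decide true p x y refl (this (Bool.f≤t , λ ()))
  scan-forced p (true ∷ x)    (true ∷ y)    = scan-continue p true x y refl (scan-forced _ x y)

  -- Correctness and running time of the sorting machine

  record Prelude (x y : Word) : Set where
    field
      exchanged : Bool
      fst snd   : Word
      sorted    : ∀ f → onSorted f x y ≡ f fst snd
      length≡   : length fst + length snd ≡ length x + length y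
      forced    : Forced sorter (M′.initial x y) (scanTime [] x)
                    (embed exchanged (M.initial fst snd))

  prelude : ∀ x y → Prelude x y
  prelude x y with scan-forced [] x y
  ... | b , ord , forced
    rewrite sym (inputTape≡tapeAt x) | sym (inputTape≡tapeAt y) = arrange b ord forced
    where
    arrange : ∀ b → Ordered b x y → Return b x y (scanTime [] x) (M′.initial x y) → Prelude x y
    arrange false x≼y forced = record
      { exchanged = false ; fst = x ; snd = y ; sorted = λ f → onSorted-≼ f x≼y
      ; length≡ = refl ; forced = forced }
    -- The tapes still hold `x` and `y` in this order, which is the exchanged initial configuration
    -- of `M` on `y` and `x`.
    arrange true y≼x forced = record
      { exchanged = true ; fst = y ; snd = x ; sorted = λ f → onSorted-≽ f y≼x
      ; length≡ = +-comm (length y) (length x) ; forced = forced }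

  -- Accepting paths are the forced prelude followed by an embedded accepting path of `M` on the
  -- sorted inputs. The prelude emits nothing and `embed` keeps the output.
  sorter-computes : ∀ {f} → Computes M f → Computes sorter (onSorted f)
  sorter-computes {f} computes x y z = mk⇔ sound complete
    where
    open Prelude (prelude x y)
    module E = Equivalence (computes fst snd z)

    sound : M′.Outputs x y z → z ≡ onSorted f x y
    sound (_ , _ , w , acc@(halted , _) , out)
      with _ , v ← Forced-shorten sorter forced w halted
      with d , u , refl ← path-embed exchanged v =
        trans (E.to (_ , d , u , accepts-embed exchanged {d} acc , out)) (sym (sorted f))

    complete : z ≡ onSorted f x y → M′.Outputs x y z
    complete eq with _ , d , w , acc , out ← E.from (trans eq (sorted f))
      with _ , v ← Forced-extend sorter forced (embed-path exchanged w) =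
        _ , embed exchanged d , v , embed-accepts exchanged {d} acc , out

  sorter-polynomial : PolynomialTime M → PolynomialTime sorter
  sorter-polynomial (p , bound) = addLinear p , bound′
    where
    -- Adds `2n + 2`, which dominates `scanTime [] x` for `length x ≤ n`; short coefficient lists
    -- are padded.
    addLinear : Polynomial → Polynomial
    addLinear []          = 2 ∷ 2 ∷ []
    addLinear (c ∷ [])    = (2 + c) ∷ 2 ∷ []
    addLinear (c ∷ d ∷ p) = (2 + c) ∷ (2 + d) ∷ p

    open +-*-Solver using (solve; _:+_; _:*_; _:=_; con)

    eval-addLinear : ∀ p n → eval (addLinear p) n ≡ (n + (n + 2)) + eval p n
    eval-addLinear [] = solve 1 (λ n →
      con 2 :+ n :* (con 2 :+ n :* con 0) := (n :+ (n :+ con 2)) :+ con 0) refl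
    eval-addLinear (c ∷ []) = λ n → solve 2 (λ c n →
      (con 2 :+ c) :+ n :* (con 2 :+ n :* con 0) :=
      (n :+ (n :+ con 2)) :+ (c :+ n :* con 0)) refl c n
    eval-addLinear (c ∷ d ∷ p) = λ n → solve 4 (λ c d e n →
      (con 2 :+ c) :+ n :* ((con 2 :+ d) :+ n :* e) :=
      (n :+ (n :+ con 2)) :+ (c :+ n :* (d :+ n :* e))) refl c d (eval p n) n

    bound′ : ∀ x y {n c} → M′.Path (M′.initial x y) n c →
             n ≤ eval (addLinear p) (length x + length y)
    bound′ x y {n} w = begin
      n
        ≤⟨ Forced-bound sorter forced relayed w ⟩
      scanTime [] x + eval p N
        ≤⟨ +-monoˡ-≤ (eval p N) (+-mono-≤ x≤N (+-monoˡ-≤ 2 x≤N)) ⟩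
      (N + (N + 2)) + eval p N
        ≡⟨ eval-addLinear p N ⟨
      eval (addLinear p) N ∎
      where
      open ≤-Reasoning
      open Prelude (prelude x y)

      N : ℕ
      N = length x + length y

      x≤N : length x ≤ N
      x≤N = m≤m+n (length x) (length y)

      relayed : ∀ {m e} → M′.Path (embed exchanged (M.initial fst snd)) m e → m ≤ eval p N
      -- The bound of `M` holds for all its paths, so the pulled-back path need not be accepting.
      relayed {m} v with _ , u , _ ← path-embed exchanged v =
        subst (λ l → m ≤ eval p l) length≡ (bound fst snd u)

-- Closure of both function classes under sorting the arguments

open SortInputs using (sorter; sorter-deterministic; sorter-polynomial; sorter-computes)

FPₜ-onSorted : ∀ {f} → FPₜ f → FPₜ (onSorted f)
FPₜ-onSorted (M , det , poly , comp) =
  sorter M , sorter-deterministic M det , sorter-polynomial M poly , sorter-computes M comp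

NPSVₜ-onSorted : ∀ {f} → NPSVₜ f → NPSVₜ (onSorted f)
NPSVₜ-onSorted (M , poly , comp) = sorter M , sorter-polynomial M poly , sorter-computes M comp

theorem4p1 : (A-P-sel ≐ CA-P-sel) × (A-NP-sel ≐ CA-NP-sel)
theorem4p1 = A-sel≐CA-sel FPₜ-onSorted , A-sel≐CA-sel NPSVₜ-onSorted
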